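{- For coprime integers $M, N \ge 1$, we have a graph isomorphism $G_M \otimes G_N \cong G_{MN}$ if and only if either $-1 \in Q_M$ or $-1 \in Q_N$.
   Context: For an integer $n \ge 1$, $\mathbb{Z}_n$ is the ring of integers modulo $n$ and $\mathbb{Z}_n^\times$ its group of units. $Q_n = \{u^2 : u \in \mathbb{Z}_n^\times\}$ is the group of quadratic units modulo $n$, and $T_n = \pm Q_n = \{\pm u^2 : u \in \mathbb{Z}_n^\times\}$. The quadratic unitary Cayley graph $G_n = \mathrm{Cay}(\mathbb{Z}_n, T_n)$ is the undirected graph with vertex set $\mathbb{Z}_n$ in which $a,b$ are adjacent iff $a-b \in T_n$ (so for $n=1$ the single vertex carries a loop). The tensor product $A \otimes B$ of graphs has vertex set $V(A)\times V(B)$, where $(u,u')$ is adjacent to $(v,v')$ iff $u$ is adjacent to $v$ in $A$ and $u'$ is adjacent to $v'$ in $B$. -}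

module Defs where

open import Level using (0ℓ)
open import Algebra.Bundles using (CommutativeRing)
open import Algebra.Definitions using (Invertible)
import Algebra.Properties.AbelianGroup as AbelianGroupProperties
import Algebra.Properties.Ring as RingProperties
open import Data.Fin.Base using (Fin; toℕ)
open import Data.Fin.Properties using (toℕ-fromℕ<; toℕ-injective; toℕ<n; toℕ≤n)
open import Data.Nat.Base as ℕ using (ℕ; NonZero; _%_; _∸_)
open import Data.Nat.DivMod
  using (_mod_; %-distribˡ-+; %-distribˡ-*; m%n<n; m<n⇒m%n≡m; n%n≡0)
import Data.Nat.Properties as ℕ
open import Data.Product.Base using (_×_; _,_; ∃-syntax)
open import Data.Product.Relation.Binary.Pointwise.NonDependent using (Pointwise; ×-symmetric)
open import Data.Sum.Base using (_⊎_; inj₁; inj₂)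
open import Function.Bundles using (_↔_; _⇔_; Inverse)
open import Relation.Binary.Core using (Rel)
open import Relation.Binary.Definitions using (Symmetric)
open import Relation.Binary.PropositionalEquality
  using (_≡_; sym; trans; cong; cong₂; subst; isEquivalence)
open import Relation.Unary using (Pred; _∈_)

------------------------------------------------------------------------
-- The ring of integers modulo n, on canonical representatives

module _ (n : ℕ) .{{_ : NonZero n}} where

  private
    π : ℕ → Fin n
    π k = k mod n

    infixl 6 _⊕_
    infixl 7 _⊛_

    _⊕_ _⊛_ : Fin n → Fin n → Fin n
    x ⊕ y = π (toℕ x ℕ.+ toℕ y)
    x ⊛ y = π (toℕ x ℕ.* toℕ y)

    ⊖_ : Fin n → Fin n
    ⊖ x = π (n ∸ toℕ x)

    toℕ-π : ∀ k → toℕ (π k) ≡ k % n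
    toℕ-π k = toℕ-fromℕ< (m%n<n k n)

    π-toℕ : ∀ x → π (toℕ x) ≡ x
    π-toℕ x = toℕ-injective (trans (toℕ-π (toℕ x)) (m<n⇒m%n≡m (toℕ<n x)))

    π-cong : ∀ {j k} → j % n ≡ k % n → π j ≡ π k
    π-cong {j} {k} eq = toℕ-injective (trans (toℕ-π j) (trans eq (sym (toℕ-π k))))

    π-+ : ∀ j k → π j ⊕ π k ≡ π (j ℕ.+ k)
    π-+ j k = trans (cong₂ (λ a b → π (a ℕ.+ b)) (toℕ-π j) (toℕ-π k))
                    (π-cong (sym (%-distribˡ-+ j k n)))

    π-* : ∀ j k → π j ⊛ π k ≡ π (j ℕ.* k)
    π-* j k = trans (cong₂ (λ a b → π (a ℕ.* b)) (toℕ-π j) (toℕ-π k))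
                    (π-cong (sym (%-distribˡ-* j k n)))

    π-+ˡ : ∀ j y → π j ⊕ y ≡ π (j ℕ.+ toℕ y)
    π-+ˡ j y = trans (cong (π j ⊕_) (sym (π-toℕ y))) (π-+ j (toℕ y))

    π-+ʳ : ∀ x k → x ⊕ π k ≡ π (toℕ x ℕ.+ k)
    π-+ʳ x k = trans (cong (_⊕ π k) (sym (π-toℕ x))) (π-+ (toℕ x) k)

    π-*ˡ : ∀ j y → π j ⊛ y ≡ π (j ℕ.* toℕ y)
    π-*ˡ j y = trans (cong (π j ⊛_) (sym (π-toℕ y))) (π-* j (toℕ y))

    π-*ʳ : ∀ x k → x ⊛ π k ≡ π (toℕ x ℕ.* k)
    π-*ʳ x k = trans (cong (_⊛ π k) (sym (π-toℕ x))) (π-* (toℕ x) k)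

    ⊕-assoc : ∀ x y z → (x ⊕ y) ⊕ z ≡ x ⊕ (y ⊕ z)
    ⊕-assoc x y z = trans (π-+ˡ (toℕ x ℕ.+ toℕ y) z)
      (trans (cong π (ℕ.+-assoc (toℕ x) (toℕ y) (toℕ z)))
             (sym (π-+ʳ x (toℕ y ℕ.+ toℕ z))))

    ⊕-comm : ∀ x y → x ⊕ y ≡ y ⊕ x
    ⊕-comm x y = cong π (ℕ.+-comm (toℕ x) (toℕ y))

    ⊕-identityˡ : ∀ x → π 0 ⊕ x ≡ x
    ⊕-identityˡ x = trans (π-+ˡ 0 x) (π-toℕ x)

    ⊕-identityʳ : ∀ x → x ⊕ π 0 ≡ x
    ⊕-identityʳ x = trans (⊕-comm x (π 0)) (⊕-identityˡ x)

    ⊖-inverseˡ : ∀ x → (⊖ x) ⊕ x ≡ π 0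
    ⊖-inverseˡ x = trans (π-+ˡ (n ∸ toℕ x) x)
      (trans (cong π (ℕ.m∸n+n≡m (toℕ≤n x)))
             (π-cong (trans (n%n≡0 n) (sym (m<n⇒m%n≡m (ℕ.>-nonZero⁻¹ n))))))

    ⊖-inverseʳ : ∀ x → x ⊕ (⊖ x) ≡ π 0
    ⊖-inverseʳ x = trans (⊕-comm x (⊖ x)) (⊖-inverseˡ x)

    ⊛-assoc : ∀ x y z → (x ⊛ y) ⊛ z ≡ x ⊛ (y ⊛ z)
    ⊛-assoc x y z = trans (π-*ˡ (toℕ x ℕ.* toℕ y) z)
      (trans (cong π (ℕ.*-assoc (toℕ x) (toℕ y) (toℕ z)))
             (sym (π-*ʳ x (toℕ y ℕ.* toℕ z))))

    ⊛-comm : ∀ x y → x ⊛ y ≡ y ⊛ x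
    ⊛-comm x y = cong π (ℕ.*-comm (toℕ x) (toℕ y))

    ⊛-identityˡ : ∀ x → π 1 ⊛ x ≡ x
    ⊛-identityˡ x = trans (π-*ˡ 1 x)
      (trans (cong π (ℕ.*-identityˡ (toℕ x))) (π-toℕ x))

    ⊛-identityʳ : ∀ x → x ⊛ π 1 ≡ x
    ⊛-identityʳ x = trans (⊛-comm x (π 1)) (⊛-identityˡ x)

    ⊛-distribˡ : ∀ x y z → x ⊛ (y ⊕ z) ≡ (x ⊛ y) ⊕ (x ⊛ z)
    ⊛-distribˡ x y z = trans (π-*ʳ x (toℕ y ℕ.+ toℕ z))
      (trans (cong π (ℕ.*-distribˡ-+ (toℕ x) (toℕ y) (toℕ z)))
             (sym (π-+ (toℕ x ℕ.* toℕ y) (toℕ x ℕ.* toℕ z))))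

    ⊛-distribʳ : ∀ x y z → (y ⊕ z) ⊛ x ≡ (y ⊛ x) ⊕ (z ⊛ x)
    ⊛-distribʳ x y z = trans (⊛-comm (y ⊕ z) x)
      (trans (⊛-distribˡ x y z) (cong₂ _⊕_ (⊛-comm x y) (⊛-comm x z)))

  ℤ/ : CommutativeRing 0ℓ 0ℓ
  ℤ/ = record
    { Carrier = Fin n
    ; _≈_     = _≡_
    ; _+_     = _⊕_
    ; _*_     = _⊛_
    ; -_      = ⊖_
    ; 0#      = π 0
    ; 1#      = π 1
    ; isCommutativeRing = record
      { isRing = record
        { +-isAbelianGroup = record
          { isGroup = record
            { isMonoid = record
              { isSemigroup = record
                { isMagma = record { isEquivalence = isEquivalence ; ∙-cong = cong₂ _⊕_ }
                ; assoc   = ⊕-assoc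
                }
              ; identity = ⊕-identityˡ , ⊕-identityʳ
              }
            ; inverse = ⊖-inverseˡ , ⊖-inverseʳ
            ; ⁻¹-cong = cong ⊖_
            }
          ; comm = ⊕-comm
          }
        ; *-cong     = cong₂ _⊛_
        ; *-assoc    = ⊛-assoc
        ; *-identity = ⊛-identityˡ , ⊛-identityʳ
        ; distrib    = ⊛-distribˡ , ⊛-distribʳ
        }
      ; *-comm = ⊛-comm
      }
    }

------------------------------------------------------------------------
-- Undirected graphs, loops allowed

record Graph : Set₁ where
  field
    Vertex  : Set
    _~_     : Rel Vertex 0ℓ
    ~-sym   : Symmetric _~_

infixr 7 _⊗_

_⊗_ : Graph → Graph → Graph
A ⊗ B = record
  { Vertex = A.Vertex × B.Vertex
  ; _~_    = Pointwise A._~_ B._~_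
  ; ~-sym  = ×-symmetric {R = A._~_} {S = B._~_} A.~-sym B.~-sym
  }
  where
  module A = Graph A
  module B = Graph B

infix 4 _≅_

-- Adjacency is a proof-relevant relation, so only its inhabitation is
-- compared across the bijection.
record _≅_ (A B : Graph) : Set where
  private
    module A = Graph A
    module B = Graph B
  field
    bijection : A.Vertex ↔ B.Vertex
    preserves : ∀ u v → (u A.~ v) ⇔ (Inverse.to bijection u B.~ Inverse.to bijection v)

------------------------------------------------------------------------
-- Quadratic unitary Cayley graphs

module _ (n : ℕ) .{{_ : NonZero n}} where

  open CommutativeRing (ℤ/ n)
    using (Carrier; _+_; _*_; _-_; -_; 1#; ring; +-abelianGroup)

  -1mod : Carrier
  -1mod = - 1#

  Unit : Pred Carrier 0ℓ
  Unit = Invertible _≡_ 1# _*_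

  Q : Pred Carrier 0ℓ
  Q x = ∃[ u ] u ∈ Unit × x ≡ u * u

  T : Pred Carrier 0ℓ
  T x = ∃[ u ] u ∈ Unit × (x ≡ u * u ⊎ x ≡ - (u * u))

  T-neg : ∀ {x} → x ∈ T → - x ∈ T
  T-neg (u , unit , inj₁ x≡u²)  = u , unit , inj₂ (cong -_ x≡u²)
  T-neg (u , unit , inj₂ x≡-u²) =
    u , unit , inj₁ (trans (cong -_ x≡-u²) (RingProperties.-‿involutive ring (u * u)))

  Cay : (S : Pred Carrier 0ℓ) → (∀ {x} → x ∈ S → - x ∈ S) → Graph
  Cay S S-neg = record
    { Vertex = Carrier
    ; _~_    = λ a b → a - b ∈ S
    ; ~-sym  = λ {a} {b} a-b∈S →
        subst S (AbelianGroupProperties.⁻¹-anti-homo-// +-abelianGroup a b) (S-neg a-b∈S)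
    }

  G : Graph
  G = Cay T T-neg

{-# OPTIONS --safe #-}

-- By the Chinese remainder theorem, G (M * N) is the Cayley graph of
-- ℤ/M × ℤ/N with connection set S = { ±(u², v²) }, whereas G M ⊗ G N has
-- connection set T M × T N ⊇ S.  If -1 is a square modulo M or N, the sign can
-- be absorbed and the two sets agree.  Conversely, an isomorphism followed by a
-- translation is a permutation of a finite set mapping T M × T N into its subset
-- S.  Since every point returns to itself under iteration, (1 , -1) ∈ S, and
-- comparing signs exhibits -1 as a square modulo M or N.
module Submission where

open import Defs
open import Algebra.Bundles using (CommutativeRing)
import Algebra.Properties.CommutativeSemigroup as CommutativeSemigroupProperties
import Algebra.Properties.Group as GroupProperties
import Algebra.Properties.Ring as RingProperties
open import Data.Fin.Base using (Fin; toℕ; combine)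
open import Data.Fin.Properties
  using (toℕ-fromℕ<; toℕ-injective; toℕ<n; pigeonhole; combine-injective)
open import Data.Nat.Base as ℕ using (ℕ; NonZero; _*_; suc; zero; _%_)
open import Data.Nat.Coprimality using (Coprime; coprime-divisor)
open import Data.Nat.Divisibility
  using (_∣_; divides-refl; m%n≡0⇒n∣m; n∣m⇒m%n≡0; *-monoˡ-∣; m∣m*n; n∣m*n)
open import Data.Nat.DivMod
  using (_mod_; %-distribˡ-+; %-distribˡ-*; m%n<n; m<n⇒m%n≡m; m∣n⇒o%n%m≡o%m)
open import Data.Nat.GeneralisedArithmetic using (fold)
open import Data.Nat.Properties using (m*n≢0; n<1+n; *-comm)
open import Data.Product.Base using (_×_; _,_; proj₁; proj₂; ∃-syntax)
open import Data.Sum.Base using (_⊎_; inj₁; inj₂; [_,_]′)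
open import Function.Base using (_∘_)
open import Function.Bundles using (_⇔_; mk⇔; mk↔ₛ′; _↔_; Inverse; Injection; Equivalence)
open import Function.Properties.Inverse using (↔-sym; ↔⇒↣)
open import Function.Definitions using (Injective)
open import Relation.Binary.PropositionalEquality
  using (_≡_; refl; sym; trans; cong; cong₂; subst; subst₂; module ≡-Reasoning)
open import Relation.Unary using (Pred; _∈_; _⊆_)

open ≡-Reasoning

-- Orbits of an injective self-map of a finite set.

module _ {n} {f : Fin n → Fin n} (f-injective : Injective _≡_ _≡_ f) where

  -- Injectivity strips one application of `f` from both sides until the shorter iterate is `x`
  -- itself; as `i < j`, at least one application is left on the other side.
  fold-cancel : ∀ x {i j} → i ℕ.< j → fold x f i ≡ fold x f j →
                ∃[ k ] fold x f (suc k) ≡ x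
  fold-cancel x {zero}  {suc j} _           eq = j , sym eq
  fold-cancel x {suc i} {suc j} (ℕ.s≤s i<j) eq = fold-cancel x i<j (f-injective eq)

  -- Among the `n + 1` iterates with exponents `0` to `n`, two coincide.
  recurrent : ∀ x → ∃[ k ] fold x f (suc k) ≡ x
  recurrent x with pigeonhole (n<1+n n) (λ i → fold x f (toℕ i))
  ... | i , j , i<j , eq = fold-cancel x i<j eq

  preimage : ∀ y → ∃[ x ] f x ≡ y
  preimage y with recurrent y
  ... | k , eq = fold y f k , eq

  -- The orbit of `x` never leaves `P`, and each step lands in `R`; so does the step that returns to
  -- `x`. This replaces a comparison of cardinalities, which would call for decidable predicates.
  ⊆-from-injection : ∀ {p q} {P : Pred (Fin n) p} {R : Pred (Fin n) q} →
                     (∀ x → x ∈ P → f x ∈ R) → (∀ x → x ∈ R → x ∈ P) → P ⊆ R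
  ⊆-from-injection {P = P} {R} step R⊆P {x} x∈P with recurrent x
  ... | k , eq = subst R eq (step (fold x f k) (orbit k))
    where
    orbit : ∀ k → fold x f k ∈ P
    orbit zero    = x∈P
    orbit (suc k) = R⊆P (fold x f (suc k)) (step (fold x f k) (orbit k))

-- Residues, squares of units and signs.

toℕ-mod : ∀ k n .{{_ : NonZero n}} → toℕ (k mod n) ≡ k % n
toℕ-mod k n = toℕ-fromℕ< (m%n<n k n)

mod-cong : ∀ {j k n} .{{_ : NonZero n}} → j % n ≡ k % n → j mod n ≡ k mod n
mod-cong {j} {k} {n} eq = toℕ-injective (trans (toℕ-mod j n) (trans eq (sym (toℕ-mod k n))))

module _ (n : ℕ) .{{_ : NonZero n}} where

  private
    module R = CommutativeRing (ℤ/ n)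
    module RP = RingProperties R.ring
    open CommutativeSemigroupProperties R.*-commutativeSemigroup using (interchange)

  1∈Q : R.1# ∈ Q n
  1∈Q = R.1# , (R.1# , R.*-identityˡ R.1# , R.*-identityˡ R.1#) , sym (R.*-identityˡ R.1#)

  Q-* : ∀ {x y} → x ∈ Q n → y ∈ Q n → x R.* y ∈ Q n
  Q-* (u , (u′ , u′u , uu′) , refl) (v , (v′ , v′v , vv′) , refl) =
    u R.* v ,
    ( u′ R.* v′
    , 1-product u′u v′v (interchange u′ v′ u v)
    , 1-product uu′ vv′ (interchange u v u′ v′)) ,
    interchange u u v v
    where
    1-product : ∀ {a b c} → a ≡ R.1# → b ≡ R.1# → c ≡ a R.* b → c ≡ R.1#
    1-product refl refl eq = trans eq (R.*-identityˡ R.1#)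

  Q⊆T : Q n ⊆ T n
  Q⊆T (u , u-unit , eq) = u , u-unit , inj₁ eq

  -Q⊆T : ∀ {x} → R.- x ∈ Q n → x ∈ T n
  -Q⊆T {x} -x∈Q = subst (T n) (RP.-‿involutive x) (T-neg n (Q⊆T -x∈Q))

  -- Moving the sign from the square to `x` lets facts about `Q` be applied to `x` or to `- x`.
  T⇒±Q : ∀ {x} → x ∈ T n → x ∈ Q n ⊎ R.- x ∈ Q n
  T⇒±Q (u , u-unit , inj₁ eq) = inj₁ (u , u-unit , eq)
  T⇒±Q (u , u-unit , inj₂ eq) =
    inj₂ (u , u-unit , trans (cong R.-_ eq) (RP.-‿involutive (u R.* u)))

  -- If `- x` is the square of a unit, then so is `x`, the product of `-1` and `- x`.
  T⊆Q : -1mod n ∈ Q n → T n ⊆ Q n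
  T⊆Q -1∈Q {x} x∈T with T⇒±Q x∈T
  ... | inj₁ x∈Q  = x∈Q
  ... | inj₂ -x∈Q = subst (Q n)
    (trans (RP.-1*x≈-x (R.- x)) (RP.-‿involutive x)) (Q-* -1∈Q -x∈Q)

-- Reduction modulo a divisor as a ring homomorphism.

module Reduction (m n : ℕ) .{{_ : NonZero m}} .{{_ : NonZero n}} (m∣n : m ∣ n) where

  private
    module A = CommutativeRing (ℤ/ n)
    module B = CommutativeRing (ℤ/ m)

  reduce : Fin n → Fin m
  reduce x = toℕ x mod m

  reduce-mod : ∀ k → reduce (k mod n) ≡ k mod m
  reduce-mod k = mod-cong (trans (cong (_% m) (toℕ-mod k n)) (m∣n⇒o%n%m≡o%m m n k m∣n))

  reduce-+ : ∀ x y → reduce (x A.+ y)  ≡ reduce x B.+ reduce y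
  reduce-+ x y = begin
    reduce (x A.+ y)  ≡⟨ reduce-mod (toℕ x ℕ.+ toℕ y) ⟩
    (toℕ x ℕ.+ toℕ y) mod m  ≡⟨ mod-cong (%-distribˡ-+ (toℕ x) (toℕ y) m) ⟩
    (toℕ x % m ℕ.+ toℕ y % m) mod m
      ≡⟨ cong₂ (λ a b → (a ℕ.+ b) mod m) (toℕ-mod (toℕ x) m) (toℕ-mod (toℕ y) m) ⟨
    reduce x B.+ reduce y  ∎

  reduce-* : ∀ x y → reduce (x A.* y)  ≡ reduce x B.* reduce y
  reduce-* x y = begin
    reduce (x A.* y)  ≡⟨ reduce-mod (toℕ x * toℕ y) ⟩
    (toℕ x * toℕ y) mod m  ≡⟨ mod-cong (%-distribˡ-* (toℕ x) (toℕ y) m) ⟩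
    (toℕ x % m * (toℕ y % m)) mod m
      ≡⟨ cong₂ (λ a b → (a * b) mod m) (toℕ-mod (toℕ x) m) (toℕ-mod (toℕ y) m) ⟨
    reduce x B.* reduce y  ∎

  reduce-neg : ∀ x → reduce (A.- x) ≡ B.- reduce x
  reduce-neg x = GroupProperties.inverseˡ-unique B.+-group (reduce (A.- x)) (reduce x) (begin
    reduce (A.- x) B.+ reduce x  ≡⟨ reduce-+ (A.- x) x ⟨
    reduce (A.- x A.+ x)         ≡⟨ cong reduce (A.-‿inverseˡ x) ⟩
    reduce A.0#                  ≡⟨ reduce-mod 0 ⟩
    B.0#                         ∎)

  reduce-sub : ∀ x y → reduce (x A.- y) ≡ reduce x B.- reduce y
  reduce-sub x y = trans (reduce-+ x (A.- y)) (cong (reduce x B.+_) (reduce-neg y))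

  reduce-1 : reduce A.1# ≡ B.1#
  reduce-1 = reduce-mod 1

  reduce-Unit : ∀ {u} → u ∈ Unit n → reduce u ∈ Unit m
  reduce-Unit {u} (u′ , u′u , uu′) =
    reduce u′ , inverse u′ u u′u , inverse u u′ uu′
    where
    inverse : ∀ a b → a A.* b ≡ A.1# → reduce a B.* reduce b ≡ B.1#
    inverse a b eq = trans (sym (reduce-* a b)) (trans (cong reduce eq) reduce-1)

  reduce-Q : ∀ {x} → x ∈ Q n → reduce x ∈ Q m
  reduce-Q (u , u-unit , refl) = reduce u , reduce-Unit u-unit , reduce-* u u

  reduce-T : ∀ {x} → x ∈ T n → reduce x ∈ T m
  reduce-T {x} x∈T with T⇒±Q n x∈T
  ... | inj₁ x∈Q  = Q⊆T m (reduce-Q x∈Q)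
  ... | inj₂ -x∈Q = -Q⊆T m (subst (Q m) (reduce-neg x) (reduce-Q -x∈Q))

  reduce≡0⇒∣ : ∀ x → reduce x ≡ B.0# → m ∣ toℕ x
  reduce≡0⇒∣ x eq = m%n≡0⇒n∣m (toℕ x) m (begin
    toℕ x % m          ≡⟨ toℕ-mod (toℕ x) m ⟨
    toℕ (reduce x)     ≡⟨ cong toℕ eq ⟩
    toℕ (0 mod m)      ≡⟨ toℕ-mod 0 m ⟩
    0 % m              ≡⟨ m<n⇒m%n≡m (ℕ.>-nonZero⁻¹ m) ⟩
    0                  ∎)

-- The Chinese remainder theorem.

coprime⇒*∣ : ∀ {m n k} → Coprime m n → m ∣ k → n ∣ k → m * n ∣ k
-- Here `k` is `q * n`, so coprimality gives `m ∣ q`, and both sides are multiplied by `n`.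
coprime⇒*∣ {m} {n} c m∣k (divides-refl q) = *-monoˡ-∣ n
  (coprime-divisor c (subst (m ∣_) (*-comm q n) m∣k))

module ChineseRemainder (M N : ℕ) .{{_ : NonZero M}} .{{_ : NonZero N}} (c : Coprime M N) where

  private
    instance
      MN≢0 : NonZero (M * N)
      MN≢0 = m*n≢0 M N

    module A = CommutativeRing (ℤ/ M)
    module B = CommutativeRing (ℤ/ N)
    module R = CommutativeRing (ℤ/ (M * N))
    module ρ₁ = Reduction M (M * N) (m∣m*n N)
    module ρ₂ = Reduction N (M * N) (n∣m*n M)

  open ρ₁ using () renaming (reduce to reduce₁)
  open ρ₂ using () renaming (reduce to reduce₂)
  open Graph (G M ⊗ G N) using () renaming (_~_ to _~⊗_)

  reduce-kernel : ∀ x → reduce₁ x ≡ A.0# → reduce₂ x ≡ B.0# → x ≡ R.0#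
  reduce-kernel x eq₁ eq₂ = toℕ-injective (begin
    toℕ x              ≡⟨ m<n⇒m%n≡m (toℕ<n x) ⟨
    toℕ x % (M * N)
      ≡⟨ n∣m⇒m%n≡0 (toℕ x) (M * N)
           (coprime⇒*∣ c (ρ₁.reduce≡0⇒∣ x eq₁) (ρ₂.reduce≡0⇒∣ x eq₂)) ⟩
    0                  ≡⟨ m<n⇒m%n≡m (ℕ.>-nonZero⁻¹ (M * N)) ⟨
    0 % (M * N)        ≡⟨ toℕ-mod 0 (M * N) ⟨
    toℕ R.0#           ∎)

  reduce-injective : ∀ x y → reduce₁ x ≡ reduce₁ y → reduce₂ x ≡ reduce₂ y → x ≡ y
  reduce-injective x y eq₁ eq₂ = GroupProperties.x∙y⁻¹≈ε⇒x≈y R.+-group x y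
    (reduce-kernel (x R.- y)
      (trans (ρ₁.reduce-sub x y) (GroupProperties.x≈y⇒x∙y⁻¹≈ε A.+-group eq₁))
      (trans (ρ₂.reduce-sub x y) (GroupProperties.x≈y⇒x∙y⁻¹≈ε B.+-group eq₂)))

  -- Existence follows from uniqueness by counting: `combine` codes pairs as elements of
  -- `Fin (M * N)`, so the pair of reductions becomes an injective self-map and hence has preimages.
  crt : ∀ a b → ∃[ x ] reduce₁ x ≡ a × reduce₂ x ≡ b
  crt a b with preimage index-injective (combine a b)
    where
    index-injective : Injective _≡_ _≡_ (λ x → combine (reduce₁ x) (reduce₂ x))
    index-injective {x} {y} eq
      with combine-injective (reduce₁ x) (reduce₂ x) (reduce₁ y) (reduce₂ y) eq
    ... | eq₁ , eq₂ = reduce-injective x y eq₁ eq₂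
  ... | x , eq = x , combine-injective (reduce₁ x) (reduce₂ x) a b eq

  crt-↔ : Fin (M * N) ↔ (Fin M × Fin N)
  crt-↔ = mk↔ₛ′ (λ x → reduce₁ x , reduce₂ x) (λ (a , b) → proj₁ (crt a b))
    (λ (a , b) → let (_ , eq₁ , eq₂) = crt a b in cong₂ _,_ eq₁ eq₂)
    (λ x → let (_ , eq₁ , eq₂) = crt (reduce₁ x) (reduce₂ x) in reduce-injective _ x eq₁ eq₂)

  -- Comparison of the two connection sets.

  -- The connection set of `G M ⊗ G N`, pulled back to `Fin (M * N)` so that it can be compared with
  -- `T (M * N)`.
  TT : Pred (Fin (M * N)) _
  TT x = reduce₁ x ∈ T M × reduce₂ x ∈ T N

  T⊆TT : T (M * N) ⊆ TT
  T⊆TT x∈T = ρ₁.reduce-T x∈T , ρ₂.reduce-T x∈T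

  reduce-Unit⁻¹ : ∀ w → reduce₁ w ∈ Unit M → reduce₂ w ∈ Unit N → w ∈ Unit (M * N)
  reduce-Unit⁻¹ w (u′ , u′u , uu′) (v′ , v′v , vv′) =
    w′
    , inverse w′ w
        (trans (cong (A._* reduce₁ w) eq₁) u′u) (trans (cong (B._* reduce₂ w) eq₂) v′v)
    , inverse w w′
        (trans (cong (reduce₁ w A.*_) eq₁) uu′) (trans (cong (reduce₂ w B.*_) eq₂) vv′)
    where
    w′ : Fin (M * N)
    w′ = proj₁ (crt u′ v′)

    eq₁ : reduce₁ w′ ≡ u′
    eq₁ = proj₁ (proj₂ (crt u′ v′))

    eq₂ : reduce₂ w′ ≡ v′
    eq₂ = proj₂ (proj₂ (crt u′ v′))

    inverse : ∀ a b → reduce₁ a A.* reduce₁ b ≡ A.1# → reduce₂ a B.* reduce₂ b ≡ B.1# →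
              a R.* b ≡ R.1#
    inverse a b eq₁ eq₂ = reduce-injective (a R.* b) R.1#
      (trans (ρ₁.reduce-* a b) (trans eq₁ (sym ρ₁.reduce-1)))
      (trans (ρ₂.reduce-* a b) (trans eq₂ (sym ρ₂.reduce-1)))

  -- The two square roots lift to one root `w` by `crt`.
  QQ⊆Q : ∀ {x} → reduce₁ x ∈ Q M → reduce₂ x ∈ Q N → x ∈ Q (M * N)
  QQ⊆Q {x} (u , u-unit , x≡uu) (v , v-unit , x≡vv) =
    w , reduce-Unit⁻¹ w (subst (Unit M) (sym eq₁) u-unit) (subst (Unit N) (sym eq₂) v-unit) ,
    reduce-injective x (w R.* w)
      (trans x≡uu (sym (trans (ρ₁.reduce-* w w) (cong₂ A._*_ eq₁ eq₁))))
      (trans x≡vv (sym (trans (ρ₂.reduce-* w w) (cong₂ B._*_ eq₂ eq₂))))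
    where
    w : Fin (M * N)
    w = proj₁ (crt u v)

    eq₁ : reduce₁ w ≡ u
    eq₁ = proj₁ (proj₂ (crt u v))

    eq₂ : reduce₂ w ≡ v
    eq₂ = proj₂ (proj₂ (crt u v))

  -QQ⊆T : ∀ {x} → A.- reduce₁ x ∈ Q M → B.- reduce₂ x ∈ Q N → x ∈ T (M * N)
  -QQ⊆T {x} q₁ q₂ = -Q⊆T (M * N) (QQ⊆Q
    (subst (Q M) (sym (ρ₁.reduce-neg x)) q₁) (subst (Q N) (sym (ρ₂.reduce-neg x)) q₂))

  -- In the component where `-1` is a square, `T` is closed under sign and lies in `Q`, so the other
  -- component alone decides whether `x` or `- x` is a square in both.
  TT⊆T : -1mod M ∈ Q M ⊎ -1mod N ∈ Q N → TT ⊆ T (M * N)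
  TT⊆T (inj₁ -1∈Q) (t₁ , t₂) with T⇒±Q N t₂
  ... | inj₁ q₂ = Q⊆T (M * N) (QQ⊆Q (T⊆Q M -1∈Q t₁) q₂)
  ... | inj₂ q₂ = -QQ⊆T (T⊆Q M -1∈Q (T-neg M t₁)) q₂
  TT⊆T (inj₂ -1∈Q) (t₁ , t₂) with T⇒±Q M t₁
  ... | inj₁ q₁ = Q⊆T (M * N) (QQ⊆Q q₁ (T⊆Q N -1∈Q t₂))
  ... | inj₂ q₁ = -QQ⊆T q₁ (T⊆Q N -1∈Q (T-neg N t₂))

  -- For `p` lifting `(1 , -1)`, a square `p` shows `-1` as a square modulo `N`, and a square `- p`
  -- shows it modulo `M`.
  TT⊆T⇒-1∈Q : TT ⊆ T (M * N) → -1mod M ∈ Q M ⊎ -1mod N ∈ Q N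
  TT⊆T⇒-1∈Q TT⊆T =
    [ (λ p∈Q → inj₂ (subst (Q N) eq₂ (ρ₂.reduce-Q p∈Q)))
    , (λ -p∈Q → inj₁
        (subst (Q M) (trans (ρ₁.reduce-neg p) (cong A.-_ eq₁)) (ρ₁.reduce-Q -p∈Q)))
    ]′ (T⇒±Q (M * N) p∈T)
    where
    p : Fin (M * N)
    p = proj₁ (crt A.1# (-1mod N))

    eq₁ : reduce₁ p ≡ A.1#
    eq₁ = proj₁ (proj₂ (crt A.1# (-1mod N)))

    eq₂ : reduce₂ p ≡ -1mod N
    eq₂ = proj₂ (proj₂ (crt A.1# (-1mod N)))

    p∈T : p ∈ T (M * N)
    p∈T = TT⊆T
      ( subst (T M) (sym eq₁) (Q⊆T M (1∈Q M))
      , subst (T N) (sym eq₂) (T-neg N (Q⊆T N (1∈Q N))) )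

  -- From connection sets to graph isomorphisms and back.

  ⊗-adjacent⇔ : ∀ x y → (reduce₁ x , reduce₂ x) ~⊗ (reduce₁ y , reduce₂ y) ⇔ x R.- y ∈ TT
  ⊗-adjacent⇔ x y = mk⇔
    (λ (t₁ , t₂) →
      subst (T M) (sym (ρ₁.reduce-sub x y)) t₁ , subst (T N) (sym (ρ₂.reduce-sub x y)) t₂)
    (λ (t₁ , t₂) →
      subst (T M) (ρ₁.reduce-sub x y) t₁ , subst (T N) (ρ₂.reduce-sub x y) t₂)

  TT⊆T⇒≅ : TT ⊆ T (M * N) → G M ⊗ G N ≅ G (M * N)
  TT⊆T⇒≅ TT⊆T = record { bijection = ↔-sym crt-↔ ; preserves = preserves }
    where
    open Inverse crt-↔ using (from; strictlyInverseˡ)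

    preserves : ∀ a b → a ~⊗ b ⇔ (from a R.- from b ∈ T (M * N))
    preserves a b = mk⇔
      (λ a~b → TT⊆T (Equivalence.to (⊗-adjacent⇔ (from a) (from b))
        (subst₂ _~⊗_ (sym (strictlyInverseˡ a)) (sym (strictlyInverseˡ b)) a~b)))
      (λ t → subst₂ _~⊗_ (strictlyInverseˡ a) (strictlyInverseˡ b)
        (Equivalence.from (⊗-adjacent⇔ (from a) (from b)) (T⊆TT t)))

  ≅⇒TT⊆T : G M ⊗ G N ≅ G (M * N) → TT ⊆ T (M * N)
  ≅⇒TT⊆T iso = ⊆-from-injection f-injective step (λ x → T⊆TT {x})
    where
    open _≅_ iso
    open Inverse bijection using (to)
    open Injection (↔⇒↣ bijection) using (injective)

    φ f : Fin (M * N) → Fin (M * N)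
    φ x = to (reduce₁ x , reduce₂ x)
    -- A point of `TT` is a neighbour of `0`; subtracting `φ R.0#` turns adjacency of the images
    -- into membership in `T (M * N)`.
    f x = φ x R.- φ R.0#

    f-injective : Injective _≡_ _≡_ f
    f-injective {x} {y} eq with injective
      (GroupProperties.∙-cancelʳ R.+-group (R.- φ R.0#) (φ x) (φ y) eq)
    ... | eq′ = reduce-injective x y (cong proj₁ eq′) (cong proj₂ eq′)

    step : ∀ x → x ∈ TT → f x ∈ T (M * N)
    step x x∈TT = Equivalence.to (preserves _ _)
      (Equivalence.from (⊗-adjacent⇔ x R.0#) (subst TT (sym x-0≡x) x∈TT))
      where
      x-0≡x : x R.- R.0# ≡ x
      x-0≡x = trans (cong (x R.+_) (GroupProperties.ε⁻¹≈ε R.+-group)) (R.+-identityʳ x)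

theorem1 : (M N : ℕ) .{{_ : NonZero M}} .{{_ : NonZero N}} → Coprime M N →
    (G M ⊗ G N ≅ G (M * N) {{m*n≢0 M N}}) ⇔ (-1mod M ∈ Q M ⊎ -1mod N ∈ Q N)
theorem1 M N c = mk⇔ (TT⊆T⇒-1∈Q ∘ ≅⇒TT⊆T) (TT⊆T⇒≅ ∘ TT⊆T)
  where open ChineseRemainder M N c
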